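{- Suppose the Boolean algebra $B$ is complete. Let $W$ be a CFG-space over $B$, let $U,V\subset W$ be arbitrary subsets, and let $F:U\to V$ be an isometry (for the restricted metrics). Then there is an isometry $F':W\to W$ whose restriction to $U$ is $F$.
   Context: A Boolean metric space over a Boolean algebra $B$ is a set $X$ with a symmetric map $d:X\times X\to B$ such that $d(x,y)=0$ iff $x=y$, and $d(x,z)\le d(x,y)\vee d(y,z)$. A map is contractive if $d(f(x),f(y))\le d(x,y)$; an isometry is a bijection preserving $d$. A partition of $B$ is a finite family of pairwise disjoint elements with supremum $1$. Given $x_0,\dots,x_n\in X$ and a partition $a_0,\dots,a_n$, $x\in X$ is a convex combination of them with these coefficients if $a_i\wedge d(x,x_i)=0$ for all $i$. $X$ is convex if such a convex combination exists in $X$ for every choice of points and partition; finitely generated if some finite $S\subset X$ has every element of $X$ as a convex combination of elements of $S$. A CFG-space is a convex, finitely generated Boolean metric space. $B$ is complete if every subset of $B$ has a supremum. -}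

module Defs where

open import Algebra.Lattice.Bundles using (BooleanAlgebra)
import Algebra.Lattice.Properties.BooleanAlgebra as BooleanAlgebraProperties
open import Data.Fin.Base using (Fin)
open import Data.List.Base using (List)
import Data.List.Membership.Setoid as Membership
open import Data.Nat.Base using (ℕ; suc)
open import Data.Product.Base using (Σ; Σ-syntax; ∃-syntax; _×_; proj₁)
import Data.Vec.Functional as Vector
open import Function.Bundles using (Bijection)
open import Function.Metric.Structures using (IsGeneralMetric)
open import Level using (Level; _⊔_) renaming (suc to lsuc)
open import Relation.Binary.Bundles using (Setoid; Poset)
open import Relation.Binary.Core using (Rel)
import Relation.Binary.Construct.On as On
open import Relation.Binary.PropositionalEquality.Core using (_≢_)
open import Relation.Unary using (Pred; _∈_)

module _ {c ℓ} (B : BooleanAlgebra c ℓ) where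

  open BooleanAlgebra B
  open Poset (BooleanAlgebraProperties.poset B) using (_≤_)

  record IsSupremum {p} (P : Pred Carrier p) (s : Carrier)
                    : Set (c ⊔ ℓ ⊔ p) where
    field
      upper : ∀ x → x ∈ P → x ≤ s
      least : ∀ y → (∀ x → x ∈ P → x ≤ y) → s ≤ y

  -- The level p bounds the subsets considered: a predicative rendering of
  -- "every subset of B has a supremum".
  Complete : (p : Level) → Set (c ⊔ ℓ ⊔ lsuc p)
  Complete p = (P : Pred Carrier p) → ∃[ s ] IsSupremum P s

  record IsPartition {n} (a : Fin n → Carrier) : Set ℓ where
    field
      disjoint : ∀ i j → i ≢ j → a i ∧ a j ≈ ⊥
      covers   : Vector.foldr _∨_ ⊥ a ≈ ⊤

  -- For this instance of IsGeneralMetric the field nonNegative (⊥ ≤ d x y)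
  -- holds automatically; what remains is that d respects equality, is
  -- symmetric, vanishes exactly on equal points and satisfies
  -- d x z ≤ d x y ∨ d y z.
  record BooleanMetricSpace (x e : Level) : Set (c ⊔ ℓ ⊔ lsuc (x ⊔ e)) where
    field
      Point    : Set x
      _≈ₚ_     : Rel Point e
      d        : Point → Point → Carrier
      isMetric : IsGeneralMetric _≈ₚ_ _≈_ _≤_ ⊥ _∨_ d

    open IsGeneralMetric isMetric public using (≈-isEquivalence)

    pointSetoid : Setoid x e
    pointSetoid = record { isEquivalence = ≈-isEquivalence }

module _ {c ℓ} {B : BooleanAlgebra c ℓ} where

  open BooleanAlgebra B using (Carrier; _≈_; _∧_; ⊥)
  open BooleanMetricSpace

  -- Two elements of the subspace are equal when their underlying points are;
  -- the membership proofs are disregarded.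
  Subspace : ∀ {x e u} (X : BooleanMetricSpace B x e) → Pred (Point X) u →
             BooleanMetricSpace B (x ⊔ u) e
  Subspace X U = record
    { Point    = Σ (Point X) U
    ; _≈ₚ_     = λ p q → _≈ₚ_ X (proj₁ p) (proj₁ q)
    ; d        = λ p q → d X (proj₁ p) (proj₁ q)
    ; isMetric = record
      { isSemiMetric = record
        { isQuasiSemiMetric = record
          { isPreMetric = record
            { isProtoMetric = record
              { isPartialOrder  = M.isPartialOrder
              ; ≈-isEquivalence = On.isEquivalence proj₁ M.≈-isEquivalence
              ; cong            = M.cong
              ; nonNegative     = M.nonNegative
              }
            ; ≈⇒0 = M.≈⇒0
            }
          ; 0⇒≈ = M.0⇒≈
          }
        ; sym = λ p q → M.sym (proj₁ p) (proj₁ q)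
        }
      ; triangle = λ p q r → M.triangle (proj₁ p) (proj₁ q) (proj₁ r)
      }
    }
    where module M = IsGeneralMetric (isMetric X)

  record Isometry {x e y f} (X : BooleanMetricSpace B x e)
                  (Y : BooleanMetricSpace B y f)
                  : Set (x ⊔ e ⊔ y ⊔ f ⊔ ℓ) where
    field
      bijection : Bijection (pointSetoid X) (pointSetoid Y)

    open Bijection bijection public using (to; cong; injective; surjective)

    field
      preserves-d : ∀ p q → d Y (to p) (to q) ≈ d X p q

  module _ {x e} (X : BooleanMetricSpace B x e) where

    IsConvexCombination : ∀ {n} → (Fin n → Carrier) → (Fin n → Point X) →
                          Point X → Set ℓ
    IsConvexCombination a xs p = ∀ i → a i ∧ d X p (xs i) ≈ ⊥

    -- Families x₀, …, xₙ are nonempty, so the empty space is convex.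
    Convex : Set (c ⊔ ℓ ⊔ x)
    Convex = ∀ {n} (xs : Fin (suc n) → Point X) (a : Fin (suc n) → Carrier) →
             IsPartition B a → ∃[ p ] IsConvexCombination a xs p

    FinitelyGenerated : Set (c ⊔ ℓ ⊔ x ⊔ e)
    FinitelyGenerated =
      Σ[ S ∈ List (Point X) ] ∀ p →
        Σ[ n ∈ ℕ ]
        Σ[ xs ∈ (Fin (suc n) → Point X) ]
        Σ[ a ∈ (Fin (suc n) → Carrier) ]
          (∀ i → xs i ∈ₛ S) × IsPartition B a × IsConvexCombination a xs p
      where open Membership (pointSetoid X) renaming (_∈_ to _∈ₛ_)

    record IsCFG : Set (c ⊔ ℓ ⊔ x ⊔ e) where
      field
        convex            : Convex
        finitelyGenerated : FinitelyGenerated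

{-# OPTIONS --safe #-}

-- Work in the internal logic of B: a condition b forces x = y when b lies below
-- the complement of d x y, and case distinctions are made by splitting b.
-- Internally W is covered by finitely many generators, and F is a partial
-- injection p i ↦ q i, which extends canonically to a permutation: send x
-- outside the domain to the beginning y of the maximal chain
--   y = p i₁, q i₁ = p i₂, …, q iₖ = x.
-- The chain has a beginning because a chain with more members than there are
-- generators would repeat itself, and x would then lie in the domain.  The
-- construction is symmetric in p and q, so it is bijective as soon as it is
-- total and injective.  Convexity turns the relation so obtained into a map.

module Submission where

open import Defs
open import Algebra.Lattice.Bundles using (BooleanAlgebra)
import Algebra.Lattice.Properties.BooleanAlgebra as BooleanAlgebraProperties
open import Data.Fin.Base using (Fin; zero; suc) renaming (_<_ to _<ᶠ_)
open import Data.Fin.Properties using (pigeonhole)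
open import Data.List.Base using (List; []; _∷_; length; lookup)
open import Data.List.Relation.Unary.Any using (index)
open import Data.List.Relation.Unary.Any.Properties using (lookup-index)
open import Data.Nat.Base using (zero; suc; _<_; _≤_; z≤n; s≤s)
import Data.Nat.Properties as ℕ
open import Data.Product.Base using (Σ; Σ-syntax; ∃-syntax; _×_; _,_; proj₁; proj₂)
import Data.Vec.Functional as Vector
open import Function.Metric.Structures using (IsGeneralMetric)
open import Level using (_⊔_)
open import Relation.Binary.Bundles using (Poset)
open import Relation.Binary.Lattice.Structures using (IsLattice)
open import Relation.Binary.PropositionalEquality.Core as ≡ using (_≡_; _≢_)
open import Relation.Nullary.Negation.Core using (contradiction)
open import Relation.Unary using (Pred)

-- Natural deduction in the internal logic of `B`.

module Forcing {c ℓ} (B : BooleanAlgebra c ℓ) where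

  open BooleanAlgebra B
  open BooleanAlgebraProperties B
  open Poset poset public
    using ()
    renaming (_≤_ to _⊑_; refl to ⊑-refl; trans to ⊑-trans; reflexive to ⊑-reflexive;
              antisym to ⊑-antisym)
  open IsLattice ∨-∧-isOrderTheoreticLattice public
    using (x≤x∨y; y≤x∨y; ∨-least; x∧y≤x; x∧y≤y; ∧-greatest)

  ⊑-⊤ : ∀ {a} → a ⊑ ⊤
  ⊑-⊤ = sym (∧-identityʳ _)

  ⊥-⊑ : ∀ {a} → ⊥ ⊑ a
  ⊥-⊑ = sym (∧-zeroˡ _)

  -- By distributivity. The branches accept any smaller stage `b′`, so eliminations nest and facts
  -- known at `b` are restricted along `b′ ⊑ b`.
  ∨-elim : ∀ {b r s t} → b ⊑ r ∨ s →
           (∀ {b′} → b′ ⊑ b → b′ ⊑ r → b′ ⊑ t) →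
           (∀ {b′} → b′ ⊑ b → b′ ⊑ s → b′ ⊑ t) → b ⊑ t
  ∨-elim b⊑r∨s f g =
    ⊑-trans (∧-greatest ⊑-refl b⊑r∨s)
      (⊑-trans (⊑-reflexive (∧-distribˡ-∨ _ _ _))
        (∨-least (f (x∧y≤x _ _) (x∧y≤y _ _)) (g (x∧y≤x _ _) (x∧y≤y _ _))))

  by-cases : ∀ {b t} r →
             (∀ {b′} → b′ ⊑ b → b′ ⊑ r → b′ ⊑ t) →
             (∀ {b′} → b′ ⊑ b → b′ ⊑ ¬ r → b′ ⊑ t) → b ⊑ t
  by-cases r = ∨-elim (⊑-trans ⊑-⊤ (⊑-reflexive (sym (∨-complementʳ r))))

  ¬-elim : ∀ {b r t} → b ⊑ r → b ⊑ ¬ r → b ⊑ t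
  ¬-elim b⊑r b⊑¬r =
    ⊑-trans (∧-greatest b⊑r b⊑¬r) (⊑-trans (⊑-reflexive (∧-complementʳ _)) ⊥-⊑)

  ¬-intro : ∀ {b r} → (∀ {b′} → b′ ⊑ b → b′ ⊑ r → b′ ⊑ ⊥) → b ⊑ ¬ r
  ¬-intro f = by-cases _ (λ b′⊑b b′⊑r → ⊑-trans (f b′⊑b b′⊑r) ⊥-⊑) (λ _ b′⊑¬r → b′⊑¬r)

  ¬-anti : ∀ {r s} → r ⊑ s → ¬ s ⊑ ¬ r
  ¬-anti r⊑s = ¬-intro λ b⊑¬s b⊑r → ¬-elim (⊑-trans b⊑r r⊑s) b⊑¬s

  ∧≈⊥⇒⊑¬ : ∀ {r s} → r ∧ s ≈ ⊥ → r ⊑ ¬ s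
  ∧≈⊥⇒⊑¬ r∧s≈⊥ = ¬-intro λ b⊑r b⊑s → ⊑-trans (∧-greatest b⊑r b⊑s) (⊑-reflexive r∧s≈⊥)

  ⋁ᶠ : ∀ {n} → (Fin n → Carrier) → Carrier
  ⋁ᶠ = Vector.foldr _∨_ ⊥

  ⋁ᶠ-upper : ∀ {n} (a : Fin n → Carrier) i → a i ⊑ ⋁ᶠ a
  ⋁ᶠ-upper a zero    = x≤x∨y _ _
  ⋁ᶠ-upper a (suc i) = ⊑-trans (⋁ᶠ-upper (Vector.tail a) i) (y≤x∨y _ _)

  ⋁ᶠ-elim : ∀ {n b t} (a : Fin n → Carrier) → b ⊑ ⋁ᶠ a →
            (∀ {b′} i → b′ ⊑ b → b′ ⊑ a i → b′ ⊑ t) → b ⊑ t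
  ⋁ᶠ-elim {zero}  a b⊑⊥ f = ⊑-trans b⊑⊥ ⊥-⊑
  ⋁ᶠ-elim {suc n} a b⊑⋁ f = ∨-elim b⊑⋁ (f zero) λ b′⊑b b′⊑⋁ →
    ⋁ᶠ-elim (Vector.tail a) b′⊑⋁ λ i b″⊑b′ → f (suc i) (⊑-trans b″⊑b′ b′⊑b)

  -- The accumulator `r` is what the earlier entries have left unclaimed.
  disjointify : ∀ {n} → Carrier → (Fin n → Carrier) → Fin n → Carrier
  disjointify r a zero    = r ∧ a zero
  disjointify r a (suc i) = disjointify (r ∧ ¬ a zero) (Vector.tail a) i

  disjointify-⊑ : ∀ {n} r (a : Fin n → Carrier) i → disjointify r a i ⊑ r ∧ a i
  disjointify-⊑ r a zero    = ⊑-refl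
  disjointify-⊑ r a (suc i) =
    ⊑-trans (disjointify-⊑ _ (Vector.tail a) i)
      (∧-greatest (⊑-trans (x∧y≤x _ _) (x∧y≤x _ _)) (x∧y≤y _ _))

  disjointify-head-tail : ∀ {n} r (a : Fin (suc n) → Carrier) i →
    disjointify r a zero ∧ disjointify r a (suc i) ⊑ ⊥
  disjointify-head-tail r a i = ¬-elim
    (⊑-trans (x∧y≤x _ _) (x∧y≤y _ _))
    (⊑-trans (x∧y≤y _ _) (⊑-trans (disjointify-⊑ _ (Vector.tail a) i)
      (⊑-trans (x∧y≤x _ _) (x∧y≤y _ _))))

  disjointify-disjoint : ∀ {n} r (a : Fin n → Carrier) i j → i ≢ j →
    disjointify r a i ∧ disjointify r a j ⊑ ⊥
  disjointify-disjoint r a zero    zero    i≢j = contradiction ≡.refl i≢j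
  disjointify-disjoint r a zero    (suc j) i≢j = disjointify-head-tail r a j
  disjointify-disjoint r a (suc i) zero    i≢j =
    ⊑-trans (⊑-reflexive (∧-comm _ _)) (disjointify-head-tail r a i)
  disjointify-disjoint r a (suc i) (suc j) i≢j =
    disjointify-disjoint _ (Vector.tail a) i j λ i≡j → i≢j (≡.cong suc i≡j)

  disjointify-covers : ∀ {n b} r (a : Fin n → Carrier) → b ⊑ r → b ⊑ ⋁ᶠ a →
                       b ⊑ ⋁ᶠ (disjointify r a)
  disjointify-covers {zero}  r a b⊑r b⊑⋁ = b⊑⋁
  disjointify-covers {suc n} r a b⊑r b⊑⋁ = by-cases (a zero)
    (λ b′⊑b b′⊑a₀ → ⊑-trans (∧-greatest (⊑-trans b′⊑b b⊑r) b′⊑a₀) (x≤x∨y _ _))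
    λ b′⊑b b′⊑¬a₀ → ⊑-trans
      (disjointify-covers _ (Vector.tail a) (∧-greatest (⊑-trans b′⊑b b⊑r) b′⊑¬a₀)
        (∨-elim (⊑-trans b′⊑b b⊑⋁)
          (λ b″⊑b′ b″⊑a₀ → ¬-elim b″⊑a₀ (⊑-trans b″⊑b′ b′⊑¬a₀))
          (λ _ b″⊑⋁ → b″⊑⋁)))
      (y≤x∨y _ _)

  disjointify-isPartition : ∀ {n} (a : Fin n → Carrier) → ⊤ ⊑ ⋁ᶠ a →
                            IsPartition B (disjointify ⊤ a)
  disjointify-isPartition a ⊤⊑⋁ = record
    { disjoint = λ i j i≢j → ⊑-antisym (disjointify-disjoint ⊤ a i j i≢j) ⊥-⊑
    ; covers   = ⊑-antisym ⊑-⊤ (disjointify-covers ⊤ a ⊑-refl ⊤⊑⋁)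
    }

  module Join {i} (complete : Complete B (ℓ ⊔ i)) {A : Set i} (f : A → Carrier) where

    private
      values : Pred Carrier (ℓ ⊔ i)
      values b = Σ[ a ∈ A ] b ≈ f a

    open IsSupremum (proj₂ (complete values))

    ⋁ : Carrier
    ⋁ = proj₁ (complete values)

    ⋁-intro : ∀ {b} a → b ⊑ f a → b ⊑ ⋁
    ⋁-intro a b⊑fa = ⊑-trans b⊑fa (upper (f a) (a , refl))

    -- The infinite distributive law: `¬ b ∨ t` is the implication from `b` to `t`, so it suffices
    -- that it is an upper bound of the values.
    ⋁-elim : ∀ {b t} → b ⊑ ⋁ → (∀ {b′} a → b′ ⊑ b → b′ ⊑ f a → b′ ⊑ t) → b ⊑ t
    ⋁-elim {b} {t} b⊑⋁ g = ∨-elim (⊑-trans b⊑⋁ (least (¬ b ∨ t) bound))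
      (λ b′⊑b b′⊑¬b → ¬-elim b′⊑b b′⊑¬b) (λ _ b′⊑t → b′⊑t)
      where
      bound : ∀ x → values x → x ⊑ ¬ b ∨ t
      bound x (a , x≈fa) = by-cases b
        (λ b′⊑x b′⊑b → ⊑-trans (g a b′⊑b (⊑-trans b′⊑x (⊑-reflexive x≈fa))) (y≤x∨y _ _))
        (λ _ b′⊑¬b → ⊑-trans b′⊑¬b (x≤x∨y _ _))

-- Truth-valued equality of points, finite covers and gluing.

module ForcedEquality {c ℓ} {B : BooleanAlgebra c ℓ} {x e} (X : BooleanMetricSpace B x e) where

  open BooleanAlgebra B using (Carrier; ¬_; ⊤; ¬-cong)
    renaming (sym to ≈-sym; trans to ≈-trans)
  open BooleanAlgebraProperties B using (¬-involutive; ¬⊥≈⊤; ¬⊤≈⊥)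
  open BooleanMetricSpace X public using (Point; _≈ₚ_; d; isMetric)
  open IsGeneralMetric isMetric public
    using (≈⇒0; 0⇒≈; sym; triangle; module EqC)
  open Forcing B

  eq : Point → Point → Carrier
  eq p q = ¬ d p q

  _≈[_]_ : Point → Carrier → Point → Set ℓ
  p ≈[ b ] q = b ⊑ eq p q

  ≈ₚ⇒≈[] : ∀ {b p q} → p ≈ₚ q → p ≈[ b ] q
  ≈ₚ⇒≈[] p≈q =
    ⊑-trans ⊑-⊤ (⊑-reflexive (≈-trans (≈-sym ¬⊥≈⊤) (¬-cong (≈-sym (≈⇒0 p≈q)))))

  ≈[]-refl : ∀ {b p} → p ≈[ b ] p
  ≈[]-refl = ≈ₚ⇒≈[] EqC.refl

  ≈[]-sym : ∀ {b p q} → p ≈[ b ] q → q ≈[ b ] p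
  ≈[]-sym b⊑ = ⊑-trans b⊑ (⊑-reflexive (¬-cong (sym _ _)))

  ≈[]-trans : ∀ {b p q r} → p ≈[ b ] q → q ≈[ b ] r → p ≈[ b ] r
  ≈[]-trans p≈q q≈r = ¬-intro λ b′⊑b b′⊑d → ∨-elim (⊑-trans b′⊑d (triangle _ _ _))
    (λ b″⊑b′ b″⊑d → ¬-elim b″⊑d (⊑-trans b″⊑b′ (⊑-trans b′⊑b p≈q)))
    (λ b″⊑b′ b″⊑d → ¬-elim b″⊑d (⊑-trans b″⊑b′ (⊑-trans b′⊑b q≈r)))

  ≈[⊤]⇒≈ₚ : ∀ {p q} → p ≈[ ⊤ ] q → p ≈ₚ q
  ≈[⊤]⇒≈ₚ {p} {q} ⊤⊑ = 0⇒≈ (≈-trans (≈-sym (¬-involutive (d p q)))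
    (≈-trans (¬-cong (⊑-antisym ⊑-⊤ ⊤⊑)) ¬⊤≈⊥))

  eq-reflects-d : ∀ {p q p′ q′} → eq p q ⊑ eq p′ q′ → d p′ q′ ⊑ d p q
  eq-reflects-d h = ⊑-trans (⊑-reflexive (≈-sym (¬-involutive _)))
    (⊑-trans (¬-anti h) (⊑-reflexive (¬-involutive _)))

  -- An internal existential over `j` in eliminated form, since different indices may serve on
  -- different pieces of `b`.
  Covers : ∀ {n} → (Fin n → Point) → Set _
  Covers s = ∀ {b t} p → (∀ {b′} j → b′ ⊑ b → p ≈[ b′ ] s j → b′ ⊑ t) → b ⊑ t

  generators-cover : ((S , _) : FinitelyGenerated X) → Covers (lookup S)
  generators-cover (S , gen) p f with gen p
  ... | n , xs , a , xs∈S , partition , combination =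
    ⋁ᶠ-elim a (⊑-trans ⊑-⊤ (⊑-reflexive (≈-sym (IsPartition.covers partition))))
      λ i b′⊑b b′⊑aᵢ → f (index (xs∈S i)) b′⊑b
        (≈[]-trans (⊑-trans b′⊑aᵢ (∧≈⊥⇒⊑¬ (combination i)))
                   (≈ₚ⇒≈[] (lookup-index (xs∈S i))))

  -- Splitting once per entry of `ps` leaves pieces on which the choice of indices is an actual
  -- function `σ`, fit for the pigeonhole principle.
  covers-simultaneously : ∀ {n} {s : Fin n → Point} → Covers s →
    ∀ {m b t} (ps : Fin m → Point) →
    (∀ {b′} (σ : Fin m → Fin n) → b′ ⊑ b → (∀ k → ps k ≈[ b′ ] s (σ k)) → b′ ⊑ t) →
    b ⊑ t
  covers-simultaneously cover {zero}  ps f = f (λ ()) ⊑-refl λ ()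
  covers-simultaneously cover {suc m} ps f = cover (ps zero) λ j b′⊑b p₀≈sⱼ →
    covers-simultaneously cover (Vector.tail ps) λ σ b″⊑b′ ps≈sσ →
      f (j Vector.∷ σ) (⊑-trans b″⊑b′ b′⊑b)
        λ { zero → ⊑-trans b″⊑b′ p₀≈sⱼ ; (suc k) → ps≈sσ k }

  -- The `a i` may overlap, so convexity is applied to their disjoint refinement. There `p` agrees
  -- with `xs i` on only a part of `a i`, but these parts still cover `⊤`.
  glue : Convex X → ∀ {n} (xs : Fin (suc n) → Point) (a : Fin (suc n) → Carrier) →
         ⊤ ⊑ ⋁ᶠ a →
         Σ[ p ∈ Point ] (∀ {t} → (∀ {b} i → b ⊑ a i → p ≈[ b ] xs i → b ⊑ t) → ⊤ ⊑ t)
  glue convex xs a ⊤⊑⋁ with convex xs (disjointify ⊤ a) (disjointify-isPartition a ⊤⊑⋁)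
  ... | p , combination = p , λ f →
    ⋁ᶠ-elim (disjointify ⊤ a) (disjointify-covers ⊤ a ⊑-refl ⊤⊑⋁)
      λ i _ b⊑ → f i
        (⊑-trans b⊑ (⊑-trans (disjointify-⊑ ⊤ a i) (x∧y≤y _ _)))
        (⊑-trans b⊑ (∧≈⊥⇒⊑¬ (combination i)))

-- The canonical extension as a `B`-valued relation.

module Extension {c ℓ} {B : BooleanAlgebra c ℓ} {x e} (X : BooleanMetricSpace B x e)
                 {i} (complete : Complete B (ℓ ⊔ i)) {I : Set i} where

  open BooleanAlgebra B using (Carrier; _≈_; _∧_; _∨_; ¬_; ⊤; ¬-cong)
    renaming (sym to ≈-sym)
  open Forcing B
  open ForcedEquality X
  open module ⋁ {A : Set i} (f : A → Carrier) = Join complete f using (⋁; ⋁-intro; ⋁-elim)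

  image : (I → Point) → Point → Carrier
  image p x = ⋁ λ i → eq x (p i)

  ¬image-resp : ∀ {p b x x′} → x ≈[ b ] x′ → b ⊑ ¬ image p x → b ⊑ ¬ image p x′
  ¬image-resp x≈x′ b⊑¬ = ¬-intro λ b′⊑b b′⊑ → ⋁-elim _ b′⊑ λ i b″⊑b′ x′≈pᵢ →
    let b″⊑b = ⊑-trans b″⊑b′ b′⊑b in
    ¬-elim (⋁-intro _ i (≈[]-trans (⊑-trans b″⊑b x≈x′) x′≈pᵢ)) (⊑-trans b″⊑b b⊑¬)

  graph : (p q : I → Point) → Point → Point → Carrier
  graph p q x y = ⋁ λ i → eq x (p i) ∧ eq y (q i)

  -- The indices form an actual list, so that arguments about chains are ordinary inductions; only
  -- `chain` quantifies over lists internally.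
  link : (p q : I → Point) → Point → List I → Point → Carrier
  link p q y []       x = eq y x
  link p q y (i ∷ is) x = eq y (p i) ∧ link p q (q i) is x

  chain : (p q : I → Point) → Point → Point → Carrier
  chain p q y x = ⋁ λ is → link p q y is x

  -- The two negated images make the chain maximal: it continues neither past `x` nor before `y`.
  ext : (p q : I → Point) → Point → Point → Carrier
  ext p q x y = graph p q x y ∨ ((¬ image p x ∧ ¬ image q y) ∧ chain p q y x)

  module _ {p q : I → Point} where

    link-resp : ∀ {b y y′ x} is → y ≈[ b ] y′ → b ⊑ link p q y is x → b ⊑ link p q y′ is x
    link-resp []       y≈y′ b⊑ = ≈[]-trans (≈[]-sym y≈y′) b⊑
    link-resp (i ∷ is) y≈y′ b⊑ =
      ∧-greatest (≈[]-trans (≈[]-sym y≈y′) (⊑-trans b⊑ (x∧y≤x _ _)))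
                 (⊑-trans b⊑ (x∧y≤y _ _))

    link-snoc : ∀ {b y x} is i → b ⊑ link p q y is (p i) → x ≈[ b ] q i →
                ∃[ is′ ] b ⊑ link p q y is′ x
    link-snoc []       i b⊑ x≈qᵢ = i ∷ [] , ∧-greatest b⊑ (≈[]-sym x≈qᵢ)
    link-snoc (j ∷ is) i b⊑ x≈qᵢ with link-snoc is i (⊑-trans b⊑ (x∧y≤y _ _)) x≈qᵢ
    ... | is′ , b⊑′ = j ∷ is′ , ∧-greatest (⊑-trans b⊑ (x∧y≤x _ _)) b⊑′

    ext-graph : ∀ {b x y} i → x ≈[ b ] p i → y ≈[ b ] q i → b ⊑ ext p q x y
    ext-graph i x≈pᵢ y≈qᵢ = ⊑-trans (⋁-intro _ i (∧-greatest x≈pᵢ y≈qᵢ)) (x≤x∨y _ _)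

    ext-chain : ∀ {b x y} is → b ⊑ ¬ image p x → b ⊑ ¬ image q y →
                b ⊑ link p q y is x → b ⊑ ext p q x y
    ext-chain is x∉ y∉ b⊑ =
      ⊑-trans (∧-greatest (∧-greatest x∉ y∉) (⋁-intro _ is b⊑)) (y≤x∨y _ _)

    ext-elim : ∀ {b t x y} → b ⊑ ext p q x y →
      (∀ {b′} i → b′ ⊑ b → x ≈[ b′ ] p i → y ≈[ b′ ] q i → b′ ⊑ t) →
      (∀ {b′} is → b′ ⊑ b → b′ ⊑ ¬ image p x → b′ ⊑ ¬ image q y →
                   b′ ⊑ link p q y is x → b′ ⊑ t) →
      b ⊑ t
    ext-elim b⊑ f g = ∨-elim b⊑
      (λ b′⊑b b′⊑graph → ⋁-elim _ b′⊑graph λ i b″⊑b′ b″⊑ →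
        f i (⊑-trans b″⊑b′ b′⊑b) (⊑-trans b″⊑ (x∧y≤x _ _)) (⊑-trans b″⊑ (x∧y≤y _ _)))
      (λ b′⊑b b′⊑ → ⋁-elim _ (⊑-trans b′⊑ (x∧y≤y _ _)) λ is b″⊑b′ b″⊑link →
        let b″⊑∉ = ⊑-trans b″⊑b′ (⊑-trans b′⊑ (x∧y≤x _ _)) in
        g is (⊑-trans b″⊑b′ b′⊑b) (⊑-trans b″⊑∉ (x∧y≤x _ _)) (⊑-trans b″⊑∉ (x∧y≤y _ _))
          b″⊑link)

  -- The chain is read backwards: its first step becomes the last one, appended by `link-snoc`.
  link-swap : ∀ {p q b y x} is → b ⊑ link p q y is x → ∃[ is′ ] b ⊑ link q p x is′ y
  link-swap []       b⊑ = [] , ≈[]-sym b⊑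
  link-swap (i ∷ is) b⊑ with link-swap is (⊑-trans b⊑ (x∧y≤y _ _))
  ... | is′ , b⊑′ = link-snoc is′ i b⊑′ (⊑-trans b⊑ (x∧y≤x _ _))

  -- This symmetry turns injectivity into single-valuedness and totality into surjectivity.
  ext-swap : ∀ {p q b x y} → b ⊑ ext p q x y → b ⊑ ext q p y x
  ext-swap b⊑ = ext-elim b⊑
    (λ i _ x≈pᵢ y≈qᵢ → ext-graph i y≈qᵢ x≈pᵢ)
    (λ is _ x∉ y∉ b′⊑ → let is′ , b′⊑′ = link-swap is b′⊑ in ext-chain is′ y∉ x∉ b′⊑′)

  ext-respʳ : ∀ {p q b x y y′} → y ≈[ b ] y′ → b ⊑ ext p q x y → b ⊑ ext p q x y′
  ext-respʳ y≈y′ b⊑ = ext-elim b⊑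
    (λ i b′⊑b x≈pᵢ y≈qᵢ →
      ext-graph i x≈pᵢ (≈[]-trans (≈[]-sym (⊑-trans b′⊑b y≈y′)) y≈qᵢ))
    (λ is b′⊑b x∉ y∉ b′⊑ → let y≈[b′]y′ = ⊑-trans b′⊑b y≈y′ in
      ext-chain is x∉ (¬image-resp y≈[b′]y′ y∉) (link-resp is y≈[b′]y′ b′⊑))

  -- Determinism of chains, injectivity and repetitions.

  module _ {p q : I → Point} (isometric : ∀ i j → d (q i) (q j) ≈ d (p i) (p j)) where

    p⇒q : ∀ {b} i j → p i ≈[ b ] p j → q i ≈[ b ] q j
    p⇒q i j pᵢ≈pⱼ = ⊑-trans pᵢ≈pⱼ (⊑-reflexive (¬-cong (≈-sym (isometric i j))))

    q⇒p : ∀ {b} i j → q i ≈[ b ] q j → p i ≈[ b ] p j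
    q⇒p i j qᵢ≈qⱼ = ⊑-trans qᵢ≈qⱼ (⊑-reflexive (¬-cong (isometric i j)))

    link-synchronise : ∀ {b y x x′} i is j js →
      b ⊑ link p q y (i ∷ is) x → b ⊑ link p q y (j ∷ js) x′ → b ⊑ link p q (q i) js x′
    link-synchronise i is j js b⊑ b⊑′ = link-resp js
      (p⇒q j i (≈[]-trans (≈[]-sym (⊑-trans b⊑′ (x∧y≤x _ _))) (⊑-trans b⊑ (x∧y≤x _ _))))
      (⊑-trans b⊑′ (x∧y≤y _ _))

    -- By `link-synchronise` both chains follow the same path; if one stopped before the other, its
    -- end would lie in the image of `p`.
    link-end-unique : ∀ {b y x x′} is js → b ⊑ ¬ image p x → b ⊑ ¬ image p x′ →
      b ⊑ link p q y is x → b ⊑ link p q y js x′ → x ≈[ b ] x′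
    link-end-unique []       []       x∉ x′∉ b⊑ b⊑′ = ≈[]-trans (≈[]-sym b⊑) b⊑′
    link-end-unique []       (j ∷ js) x∉ x′∉ b⊑ b⊑′ =
      ¬-elim (⋁-intro _ j (≈[]-trans (≈[]-sym b⊑) (⊑-trans b⊑′ (x∧y≤x _ _)))) x∉
    link-end-unique (i ∷ is) []       x∉ x′∉ b⊑ b⊑′ =
      ¬-elim (⋁-intro _ i (≈[]-trans (≈[]-sym b⊑′) (⊑-trans b⊑ (x∧y≤x _ _)))) x′∉
    link-end-unique (i ∷ is) (j ∷ js) x∉ x′∉ b⊑ b⊑′ =
      link-end-unique is js x∉ x′∉ (⊑-trans b⊑ (x∧y≤y _ _))
        (link-synchronise i is j js b⊑ b⊑′)

    -- On the common path, the longer chain still takes a step from the point where the shorter one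
    -- ends.
    link-shorter : ∀ {b y x x′} is js → length js < length is →
      b ⊑ link p q y is x → b ⊑ link p q y js x′ → b ⊑ image p x′
    link-shorter (i ∷ is) []       _         b⊑ b⊑′ =
      ⋁-intro _ i (≈[]-trans (≈[]-sym b⊑′) (⊑-trans b⊑ (x∧y≤x _ _)))
    link-shorter (i ∷ is) (j ∷ js) (s≤s lt) b⊑ b⊑′ =
      link-shorter is js lt (⊑-trans b⊑ (x∧y≤y _ _)) (link-synchronise i is j js b⊑ b⊑′)

    -- Two graph cases are settled by the isometry, two chain cases by `link-end-unique`; mixed
    -- cases conflict on whether `y` is in the image of `q`.
    ext-injective : ∀ {b x y x′ y′} → b ⊑ ext p q x y → b ⊑ ext p q x′ y′ →
                    y ≈[ b ] y′ → x ≈[ b ] x′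
    ext-injective b⊑ b⊑′ y≈y′ = ext-elim b⊑
      (λ i b₁⊑b x≈pᵢ y≈qᵢ → ext-elim (⊑-trans b₁⊑b b⊑′)
        (λ j b₂⊑b₁ x′≈pⱼ y′≈qⱼ →
          let y≈y′₂ = ⊑-trans (⊑-trans b₂⊑b₁ b₁⊑b) y≈y′ in
          ≈[]-trans (⊑-trans b₂⊑b₁ x≈pᵢ)
            (≈[]-trans
              (q⇒p i j (≈[]-trans (≈[]-sym (⊑-trans b₂⊑b₁ y≈qᵢ)) (≈[]-trans y≈y′₂ y′≈qⱼ)))
              (≈[]-sym x′≈pⱼ)))
        (λ js b₂⊑b₁ _ y′∉ _ →
          let y≈y′₂ = ⊑-trans (⊑-trans b₂⊑b₁ b₁⊑b) y≈y′ in
          ¬-elim (⋁-intro _ i (≈[]-trans (≈[]-sym y≈y′₂) (⊑-trans b₂⊑b₁ y≈qᵢ))) y′∉))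
      (λ is b₁⊑b x∉ y∉ link₁ → ext-elim (⊑-trans b₁⊑b b⊑′)
        (λ j b₂⊑b₁ _ y′≈qⱼ →
          let y≈y′₂ = ⊑-trans (⊑-trans b₂⊑b₁ b₁⊑b) y≈y′ in
          ¬-elim (⋁-intro _ j (≈[]-trans y≈y′₂ y′≈qⱼ)) (⊑-trans b₂⊑b₁ y∉))
        (λ js b₂⊑b₁ x′∉ _ link₂ →
          let y≈y′₂ = ⊑-trans (⊑-trans b₂⊑b₁ b₁⊑b) y≈y′ in
          link-end-unique is js (⊑-trans b₂⊑b₁ x∉) x′∉ (⊑-trans b₂⊑b₁ link₁)
            (link-resp js (≈[]-sym y≈y′₂) link₂)))

    member : (is : List I) → Point → Fin (suc (length is)) → Point
    member []       x _       = x
    member (i ∷ is) x zero    = p i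
    member (i ∷ is) x (suc k) = member is x k

    link-from-member : ∀ {b y x} is (k : Fin (suc (length is))) → b ⊑ link p q y is x →
      ∃[ js ] length js ≤ length is × b ⊑ link p q (member is x k) js x
    link-from-member []       k       b⊑ = [] , z≤n , ≈[]-refl
    link-from-member (i ∷ is) zero    b⊑ =
      i ∷ is , ℕ.≤-refl , ∧-greatest ≈[]-refl (⊑-trans b⊑ (x∧y≤y _ _))
    link-from-member (i ∷ is) (suc k) b⊑
      with js , le , b⊑′ ← link-from-member is k (⊑-trans b⊑ (x∧y≤y _ _))
      = js , ℕ.m≤n⇒m≤1+n le , b⊑′

    -- After the steps before `k` are dropped, the remaining chain and its suffix from `l` start at
    -- equal points and both end at `x`, but the suffix is shorter, so `link-shorter` applies.
    link-repetition : ∀ {b y x} is {k l : Fin (suc (length is))} → k <ᶠ l →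
      b ⊑ link p q y is x → member is x k ≈[ b ] member is x l → b ⊑ image p x
    link-repetition []       {zero}  {zero}  () _ _
    link-repetition (i ∷ is) {zero}  {suc l} _ b⊑ pᵢ≈
      with js , le , b⊑′ ← link-from-member is l (⊑-trans b⊑ (x∧y≤y _ _))
      = link-shorter (i ∷ is) js (s≤s le)
          (link-resp (i ∷ is) (⊑-trans b⊑ (x∧y≤x _ _)) b⊑)
          (link-resp js (≈[]-sym pᵢ≈) b⊑′)
    link-repetition (i ∷ is) {suc k} {suc l} (s≤s k<l) b⊑ eq =
      link-repetition is k<l (⊑-trans b⊑ (x∧y≤y _ _)) eq

    -- Totality from a finite cover.

    module _ {n} {s : Fin n → Point} (cover : Covers s) where

      -- A chain of `n` steps has `n` + 1 members, so two of them fall on the same `s j`.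
      long-link-ends-in-image : ∀ {b y x} is → length is ≡ n →
        b ⊑ link p q y is x → b ⊑ image p x
      long-link-ends-in-image {x = x} is ≡.refl b⊑ =
        covers-simultaneously cover (member is x) λ σ b′⊑b members≈ →
          let k , l , k<l , σk≡σl = pigeonhole (ℕ.n<1+n _) σ in
          link-repetition is k<l (⊑-trans b′⊑b b⊑)
            (≈[]-trans (members≈ k)
              (≡.subst (λ m → s m ≈[ _ ] member is x l) (≡.sym σk≡σl) (≈[]-sym (members≈ l))))

      module _ {x t} (hit : ∀ {b} j → b ⊑ ext p q x (s j) → b ⊑ t) where

        hit-any : ∀ {b} y → b ⊑ ext p q x y → b ⊑ t
        hit-any y b⊑ = cover y λ j b′⊑b y≈sⱼ → hit j (ext-respʳ y≈sⱼ (⊑-trans b′⊑b b⊑))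

        -- Induction on `k`: where the beginning `y` is some `q i`, the chain grows by one step at
        -- the front; elsewhere it is maximal and `y` is a value for `x`, which yields `t` at once.
        trace-back : ∀ {b} → b ⊑ ¬ image p x → ∀ k →
          (∀ {b′} is y → b′ ⊑ b → length is ≡ k → b′ ⊑ link p q y is x → b′ ⊑ t) → b ⊑ t
        trace-back x∉ zero    f = f [] x ⊑-refl ≡.refl ≈[]-refl
        trace-back x∉ (suc k) f = trace-back x∉ k λ is y b₁⊑b len b₁⊑ →
          by-cases (image q y)
            (λ b₂⊑b₁ y∈ → ⋁-elim _ y∈ λ i b₃⊑b₂ y≈qᵢ →
              let b₃⊑b₁ = ⊑-trans b₃⊑b₂ b₂⊑b₁ in
              f (i ∷ is) (p i) (⊑-trans b₃⊑b₁ b₁⊑b) (≡.cong suc len)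
                (∧-greatest ≈[]-refl (link-resp is y≈qᵢ (⊑-trans b₃⊑b₁ b₁⊑))))
            (λ b₂⊑b₁ y∉ → hit-any y
              (ext-chain is (⊑-trans (⊑-trans b₂⊑b₁ b₁⊑b) x∉) y∉ (⊑-trans b₂⊑b₁ b₁⊑)))

        ext-total : ⊤ ⊑ t
        ext-total = by-cases (image p x)
          (λ _ x∈ → ⋁-elim _ x∈ λ i _ x≈pᵢ → hit-any (q i) (ext-graph i x≈pᵢ ≈[]-refl))
          (λ _ x∉ → trace-back x∉ n λ is y b′⊑b len b′⊑ →
            ¬-elim (long-link-ends-in-image is len b′⊑) (⊑-trans b′⊑b x∉))

      abstract
        -- Each candidate carries as coefficient the truth value of its being related to `x`, so the
        -- glued point is related to `x` on every piece, even where the dummy entry is selected.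
        ext-value : Convex X → ∀ x → Σ[ y ∈ Point ] ⊤ ⊑ ext p q x y
        ext-value convex x =
          let y , elim = glue convex xs a (ext-total λ j b⊑ → ⊑-trans b⊑ (⋁ᶠ-upper a (suc j)))
          in y , elim λ i b⊑ y≈xsᵢ → ext-respʳ (≈[]-sym y≈xsᵢ) b⊑
          where
          -- Convexity needs a nonempty family, hence the dummy entry x.
          xs : Fin (suc n) → Point
          xs = x Vector.∷ s
          a : Fin (suc n) → Carrier
          a i = ext p q x (xs i)

theorem3 : ∀ {c ℓ w e u v} (B : BooleanAlgebra c ℓ) → Complete B (ℓ ⊔ w ⊔ u) →
    (W : BooleanMetricSpace B w e) → IsCFG W →
    (U : Pred (BooleanMetricSpace.Point W) u) (V : Pred (BooleanMetricSpace.Point W) v)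
    (F : Isometry (Subspace W U) (Subspace W V)) →
    Σ[ F′ ∈ Isometry W W ] (∀ x → BooleanMetricSpace._≈ₚ_ W (Isometry.to F′ (proj₁ x)) (proj₁ (Isometry.to F x)))
theorem3 B complete W cfg U V F = F′ , extends
  where
  open BooleanAlgebra B using (_≈_) renaming (sym to ≈-sym)
  open Forcing B
  open ForcedEquality W
  open Extension W complete {I = Σ Point U}
  open IsCFG cfg

  p q : Σ Point U → Point
  p = proj₁
  q i = proj₁ (Isometry.to F i)

  isometric : ∀ i j → d (q i) (q j) ≈ d (p i) (p j)
  isometric = Isometry.preserves-d F

  isometric⁻¹ : ∀ i j → d (p i) (p j) ≈ d (q i) (q j)
  isometric⁻¹ i j = ≈-sym (isometric i j)

  cover : Covers (lookup (proj₁ finitelyGenerated))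
  cover = generators-cover finitelyGenerated

  to : Point → Point
  to x = proj₁ (ext-value isometric cover convex x)

  from : Point → Point
  from y = proj₁ (ext-value isometric⁻¹ cover convex y)

  to-ext : ∀ {b} x → b ⊑ ext p q x (to x)
  to-ext x = ⊑-trans ⊑-⊤ (proj₂ (ext-value isometric cover convex x))

  functional : ∀ {b x y x′ y′} → b ⊑ ext p q x y → b ⊑ ext p q x′ y′ →
               x ≈[ b ] x′ → y ≈[ b ] y′
  functional b⊑ b⊑′ = ext-injective isometric⁻¹ (ext-swap b⊑) (ext-swap b⊑′)

  to-cong : ∀ {x x′} → x ≈ₚ x′ → to x ≈ₚ to x′
  to-cong x≈x′ = ≈[⊤]⇒≈ₚ (functional (to-ext _) (to-ext _) (≈ₚ⇒≈[] x≈x′))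

  F′ : Isometry W W
  F′ = record
    { bijection = record
      { to        = to
      ; cong      = to-cong
      ; bijective =
          (λ to-x≈to-x′ →
            ≈[⊤]⇒≈ₚ (ext-injective isometric (to-ext _) (to-ext _) (≈ₚ⇒≈[] to-x≈to-x′)))
        -- The value of the extension of the inverse is a preimage, since its defining relation,
        -- swapped, relates `from y` to `y`.
        , λ y → from y , λ z≈from-y → ≈[⊤]⇒≈ₚ (functional (to-ext _)
            (ext-swap (proj₂ (ext-value isometric⁻¹ cover convex y))) (≈ₚ⇒≈[] z≈from-y))
      }
    -- Taking as stage the equality of the arguments, or that of the values, turns single-valuedness
    -- and injectivity into the two inequalities.
    ; preserves-d = λ x x′ → ⊑-antisym
        (eq-reflects-d (functional (to-ext x) (to-ext x′) ⊑-refl))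
        (eq-reflects-d (ext-injective isometric (to-ext x) (to-ext x′) ⊑-refl))
    }

  extends : ∀ x → to (proj₁ x) ≈ₚ proj₁ (Isometry.to F x)
  extends x = ≈[⊤]⇒≈ₚ (functional (to-ext (proj₁ x)) (ext-graph x ≈[]-refl ≈[]-refl) ≈[]-refl)
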